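{- Let $n\ge2$ and let $\mathfrak D_n$ be the subgroup of the signed permutation group $\mathfrak B_n$ generated by $t_0=\tau_0\tau_1\tau_0$ and $t_i=\tau_i$ for $1\le i\le n-1$ (so $t_0(1)=-2$, $t_0(2)=-1$), considered as a Coxeter group with generators $\{t_0,\dots,t_{n-1}\}$. Let $u\in\mathfrak D_n$ and put $u(0)=0$, and let $A(u)=\{t_i: i\ne1,\ |u(j)|<u(k)\ \text{for all }0\le j\le i<k\le n\}$. If either ($u(1)=1$ and $u(k)>0$ for all $1\le k\le n$) or ($u(1)<-1$, $u^{ -1}(1)<-1$ and $|\{1\le i\le n:u(i)<0\}|=2$), then $C(u)=\{t_1\}\cup A(u)$; otherwise $C(u)=A(u)$.
   Context: $\mathfrak B_n$ consists of the permutations $w$ of $\{\pm1,\dots,\pm n\}$ with $w(-i)=-w(i)$; $\tau_0=(-1,1)$ and $\tau_i=(i,i+1)(-i,-i-1)$ for $i\ge1$. For $w$ in a Coxeter system, $C(w)$ is the set of simple generators not occurring in any reduced expression of $w$. -}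

module Defs where

open import Data.Nat using (ℕ; zero; suc; _≤_; _<_)
open import Data.Integer using (ℤ; +_; -[1+_]; -_; ∣_∣) renaming (_<_ to _<ℤ_)
import Data.Integer as ℤ
open import Data.Fin using (Fin; toℕ)
open import Data.Vec using (Vec; []; _∷_; map; tabulate)
open import Data.List using (List; length)
open import Data.List.Membership.Propositional using (_∈_)
open import Data.Product using (Σ; ∃; _×_)
open import Data.Bool using (if_then_else_)
open import Relation.Nullary using (¬_; does)
open import Relation.Binary.PropositionalEquality using (_≡_)

-- Signed permutations of {±1,…,±n} are represented by their window
-- (w(1),…,w(n)) : Vec ℤ n; w(-i) = -w(i), w(0) = 0.

-- τ_i as a permutation of ℤ (fixing everything outside {±1,…,±n} is harmless).
τ : ℕ → ℤ → ℤ
τ zero x = if does (x ℤ.≟ + 1) then - (+ 1)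
           else if does (x ℤ.≟ - (+ 1)) then + 1 else x
τ (suc i) x =
  let a = + (suc i) ; b = + (suc (suc i)) in
  if does (x ℤ.≟ a) then b
  else if does (x ℤ.≟ b) then a
  else if does (x ℤ.≟ - a) then - b
  else if does (x ℤ.≟ - b) then - a
  else x

-- generators of 𝔇_n : t_0 = τ_0 τ_1 τ_0, t_i = τ_i
t : ℕ → ℤ → ℤ
t zero x = τ 0 (τ 1 (τ 0 x))
t (suc i) x = τ (suc i) x

-- identity window
idW : (n : ℕ) → Vec ℤ n
idW n = tabulate (λ i → + suc (toℕ i))

-- value of the product t_{a₁} t_{a₂} ⋯ t_{a_k} (composition of maps,
-- rightmost applied first), as a window
eval : {n : ℕ} → List (Fin n) → Vec ℤ n
eval {n} Data.List.[] = idW n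
eval (a Data.List.∷ w) = map (t (toℕ a)) (eval w)

-- u ∈ 𝔇_n
InD : {n : ℕ} → Vec ℤ n → Set
InD u = ∃ λ w → eval w ≡ u

-- reduced expression of u
Reduced : {n : ℕ} → Vec ℤ n → List (Fin n) → Set
Reduced u w = (eval w ≡ u) × (∀ w' → eval w' ≡ u → length w ≤ length w')

-- C(u): t_i occurs in no reduced expression of u
InC : {n : ℕ} → Vec ℤ n → Fin n → Set
InC u i = ¬ (∃ λ w → Reduced u w × i ∈ w)

-- u(j) for j : ℕ, with u(0) = 0 (u(j) = u_j for 1 ≤ j ≤ n)
lookupℕ : {n : ℕ} → Vec ℤ n → ℕ → ℤ
lookupℕ [] _ = + 0
lookupℕ (x ∷ xs) zero = x
lookupℕ (x ∷ xs) (suc m) = lookupℕ xs m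

uN : {n : ℕ} → Vec ℤ n → ℕ → ℤ
uN u zero = + 0
uN u (suc m) = lookupℕ u m

-- u extended to ℤ: u(0)=0, u(-j) = -u(j)
uExt : {n : ℕ} → Vec ℤ n → ℤ → ℤ
uExt u (+ m) = uN u m
uExt u -[1+ m ] = - lookupℕ u m

-- t_i ∈ A(u)
InA : {n : ℕ} → Vec ℤ n → Fin n → Set
InA {n} u i = (¬ toℕ i ≡ 1) ×
  (∀ j k → j ≤ toℕ i → toℕ i < k → k ≤ n → + ∣ uN u j ∣ <ℤ uN u k)

-- |{1 ≤ i ≤ n : u(i) < 0}|
negCount : {n : ℕ} → Vec ℤ n → ℕ
negCount [] = 0
negCount (x ∷ xs) = if does (x ℤ.<? + 0) then suc (negCount xs) else negCount xs

-- the special condition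
Special : {n : ℕ} → Vec ℤ n → Set
Special {n} u =
  ((uN u 1 ≡ + 1) × (∀ k → 1 ≤ k → k ≤ n → + 0 <ℤ uN u k))
  Data.Sum.⊎
  ((uN u 1 <ℤ - (+ 1)) ×
   (∃ λ x → (uExt u x ≡ + 1) × (x <ℤ - (+ 1))) ×   -- u⁻¹(1) < -1
   (negCount u ≡ 2))
  where import Data.Sum

-- Every generator condition is an invariant of a standard parabolic
-- subgroup, read off the window (u(1), …, u(n)): u ∈ ⟨t_c : c ≠ 0⟩ keeps all
-- entries positive, and u ∈ ⟨t_c : c ≠ i⟩ (i ≥ 2) keeps the values ±1, …, ±i
-- in the first i places and positive values after them; conjugation by τ₀
-- exchanges t₀ and t₁ and turns the condition for t₁ into the one for t₀.
-- So if t_i occurs in no reduced word of u, u satisfies the invariant.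
-- Conversely, by the deletion condition the inversions u r < u acquired along
-- a reduced word are never lost again; if t_i occurs, the part of the word
-- to the right of its last occurrence lies in the parabolic subgroup, and
-- the letter t_i then creates an inversion that the condition on u excludes.

module Submission where

open import Defs
open import Data.Bool using (Bool; true; false; _∨_; if_then_else_)
open import Data.Bool.Properties using (T-≡; ¬-not; not-¬)
open import Data.Empty using (⊥-elim)
open import Data.Fin as Fin using (Fin; toℕ)
import Data.Fin.Properties as Finₚ
open import Data.Integer as ℤ using (ℤ; +_; -[1+_]; -_; ∣_∣; sign; _◃_)
import Data.Integer.Properties as ℤₚ
open import Data.List as List using (List; []; _∷_; _++_; length)
import Data.List.Properties as Listₚ
open import Data.List.Membership.Propositional using (_∈_; _∉_)
open import Data.List.Membership.DecPropositional using (_∈?_)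
open import Data.List.Membership.Propositional.Properties using (∈-map⁺)
open import Data.List.Relation.Unary.Any using (here; there)
open import Data.Nat as ℕ using (ℕ; zero; suc; _+_; _≤_; _<_; z≤n; s≤s; _≡ᵇ_; _<ᵇ_)
import Data.Nat.Properties as ℕₚ
open import Data.Product using (∃; ∃₂; _×_; _,_; proj₁; proj₂; uncurry)
open import Data.Sign as Sign using (Sign; opposite)
import Data.Sign.Properties as Signₚ
open import Data.Sum using (_⊎_; inj₁; inj₂; [_,_])
open import Data.Vec using (Vec; []; _∷_; map; tabulate)
import Data.Vec.Properties as Vecₚ
open import Function.Base using (_∘_)
open import Function.Bundles using (_⇔_; mk⇔; Equivalence)
open import Relation.Binary using (DecidableEquality; tri<; tri≈; tri>)
open import Relation.Binary.PropositionalEquality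
  using (_≡_; _≢_; refl; sym; trans; cong; cong₂; subst; subst₂; module ≡-Reasoning)
open import Relation.Nullary using (¬_; Dec; yes; no)
open import Relation.Unary using (Decidable)

least-witness : (Q : ℕ → Set) → Decidable Q → ∀ {n} → Q n →
                ∃ λ m → Q m × (∀ k → k < m → ¬ Q k)
least-witness Q Q? {n} q = go 0 n (λ _ ()) q
  where
  go : ∀ k g → (∀ j → j < k → ¬ Q j) → Q (k + g) → ∃ λ m → Q m × (∀ j → j < m → ¬ Q j)
  go k zero below q′ = k , subst Q (ℕₚ.+-identityʳ k) q′ , below
  go k (suc g) below q′ with Q? k
  ... | yes qk = k , qk , below
  ... | no ¬qk = go (suc k) g below′ (subst Q (ℕₚ.+-suc k g) q′)
    where
    below′ : ∀ j → j < suc k → ¬ Q j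
    below′ j (s≤s j≤k) with ℕₚ.m≤n⇒m<n∨m≡n j≤k
    ... | inj₁ j<k = below j j<k
    ... | inj₂ refl = ¬qk

module _ {A : Set} (_≟_ : DecidableEquality A) where

  split-last : ∀ {x : A} {xs} → x ∈ xs → ∃₂ λ ys zs → xs ≡ ys ++ x ∷ zs × x ∉ zs
  split-last {x} {y ∷ xs} x∈ with _∈?_ _≟_ x xs
  ... | yes x∈xs with ys , zs , refl , x∉zs ← split-last x∈xs = y ∷ ys , zs , refl , x∉zs
  split-last (here refl)   | no x∉xs = [] , _ , refl , x∉xs
  split-last (there x∈xs)  | no x∉xs = ⊥-elim (x∉xs x∈xs)

⇔-inj₂ : ∀ {A B P : Set} → ¬ P → A ⇔ B → A ⇔ (P ⊎ B)
⇔-inj₂ ¬p A⇔B = mk⇔ (inj₂ ∘ Equivalence.to A⇔B) [ ⊥-elim ∘ ¬p , Equivalence.from A⇔B ]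

≡ᵇ-refl : ∀ m → (m ≡ᵇ m) ≡ true
≡ᵇ-refl m = Equivalence.to T-≡ (ℕₚ.≡⇒≡ᵇ m m refl)

≡ᵇ⇒≡ : ∀ {m n} → (m ≡ᵇ n) ≡ true → m ≡ n
≡ᵇ⇒≡ {m} {n} eq = ℕₚ.≡ᵇ⇒≡ m n (Equivalence.from T-≡ eq)

≡ᵇ≡false⇒≢ : ∀ {m n} → (m ≡ᵇ n) ≡ false → m ≢ n
≡ᵇ≡false⇒≢ {m} ne refl = not-¬ (≡ᵇ-refl m) ne

≢⇒≡ᵇ≡false : ∀ {m n} → m ≢ n → (m ≡ᵇ n) ≡ false
≢⇒≡ᵇ≡false m≢n = ¬-not (m≢n ∘ ≡ᵇ⇒≡)

<⇒<ᵇ≡true : ∀ {m n} → m < n → (m <ᵇ n) ≡ true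
<⇒<ᵇ≡true m<n = Equivalence.to T-≡ (ℕₚ.<⇒<ᵇ m<n)

≮⇒<ᵇ≡false : ∀ {m n} → ¬ m < n → (m <ᵇ n) ≡ false
≮⇒<ᵇ≡false {m} {n} m≮n = ¬-not (m≮n ∘ ℕₚ.<ᵇ⇒< m n ∘ Equivalence.from T-≡)

<ᵇ-suc : ∀ {m a} → m ≢ a → (m <ᵇ suc a) ≡ (m <ᵇ a)
<ᵇ-suc {zero}  {zero}  m≢a = ⊥-elim (m≢a refl)
<ᵇ-suc {zero}  {suc a} _   = refl
<ᵇ-suc {suc m} {zero}  _   = refl
<ᵇ-suc {suc m} {suc a} m≢a = <ᵇ-suc (λ e → m≢a (cong suc e))

suc-<ᵇ : ∀ {m a} → m ≢ suc a → (suc a <ᵇ m) ≡ (a <ᵇ m)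
suc-<ᵇ {zero}        {a}     _   = refl
suc-<ᵇ {suc zero}    {zero}  m≢1 = ⊥-elim (m≢1 refl)
suc-<ᵇ {suc (suc m)} {zero}  _   = refl
suc-<ᵇ {suc m}       {suc a} m≢a = suc-<ᵇ (λ e → m≢a (cong suc e))

neg-◃ : ∀ s m → - (s ◃ m) ≡ opposite s ◃ m
neg-◃ _        zero    = refl
neg-◃ Sign.+   (suc m) = refl
neg-◃ Sign.-   (suc m) = refl

-- Generators on signs and absolute values

swap : ℕ → ℕ → ℕ
swap a m = if m ≡ᵇ a then suc a else if m ≡ᵇ suc a then a else m

-- t_c acts on absolute values as the transposition (pivot c, pivot c + 1),
-- and t_0 moreover changes the sign of the two values it moves.
pivot : ℕ → ℕ
pivot zero    = 1
pivot (suc i) = suc i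

moves : ℕ → ℕ → Bool
moves c m = (m ≡ᵇ pivot c) ∨ (m ≡ᵇ suc (pivot c))

flip : ℕ → ℕ → Sign
flip zero    m = if moves zero m then Sign.- else Sign.+
flip (suc i) m = Sign.+

t-signAbs : ∀ c z → t c z ≡ (sign z Sign.* flip c ∣ z ∣) ◃ swap (pivot c) ∣ z ∣
t-signAbs (suc i) (+ zero) = refl
t-signAbs (suc i) (+ suc m) with m ≡ᵇ i | m ≡ᵇ suc i
... | true  | _     = refl
... | false | true  = refl
... | false | false = refl
t-signAbs (suc i) -[1+ m ] with m ≡ᵇ i | m ≡ᵇ suc i
... | true  | _     = refl
... | false | true  = refl
... | false | false = refl
t-signAbs zero (+ zero)                = refl
t-signAbs zero (+ suc zero)            = refl
t-signAbs zero (+ suc (suc zero))      = refl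
t-signAbs zero (+ suc (suc (suc m)))   = refl
t-signAbs zero -[1+ zero ]             = refl
t-signAbs zero -[1+ suc zero ]         = refl
t-signAbs zero -[1+ suc (suc m) ]      = refl

swap-suc : ∀ a m → swap (suc a) (suc m) ≡ suc (swap a m)
swap-suc a m with m ≡ᵇ a | m ≡ᵇ suc a
... | true  | _     = refl
... | false | true  = refl
... | false | false = refl

swap-at : ∀ a → swap a a ≡ suc a
swap-at zero    = refl
swap-at (suc a) = trans (swap-suc a a) (cong suc (swap-at a))

swap-above : ∀ a → swap a (suc a) ≡ a
swap-above zero    = refl
swap-above (suc a) = trans (swap-suc a (suc a)) (cong suc (swap-above a))

swap-outside : ∀ {a m} → m ≢ a → m ≢ suc a → swap a m ≡ m
swap-outside m≢a m≢1+a rewrite ≢⇒≡ᵇ≡false m≢a | ≢⇒≡ᵇ≡false m≢1+a = refl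

data Position (a : ℕ) : ℕ → Set where
  at      : Position a a
  above   : Position a (suc a)
  outside : ∀ {m} → m ≢ a → m ≢ suc a → Position a m

position : ∀ a m → Position a m
position a m with m ℕ.≟ a | m ℕ.≟ suc a
... | yes refl | _        = at
... | no _     | yes refl = above
... | no m≢a   | no m≢1+a = outside m≢a m≢1+a

swap-involutive : ∀ a m → swap a (swap a m) ≡ m
swap-involutive a m with position a m
... | at    rewrite swap-at a    = swap-above a
... | above rewrite swap-above a = swap-at a
... | outside m≢a m≢1+a rewrite swap-outside m≢a m≢1+a = swap-outside m≢a m≢1+a

swap-≤ : ∀ {a m b} → m ≤ b → a ≢ b → swap a m ≤ b
swap-≤ {a} {m} m≤b a≢b with position a m
... | at    rewrite swap-at a    = ℕₚ.≤∧≢⇒< m≤b a≢b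
... | above rewrite swap-above a = ℕₚ.<⇒≤ m≤b
... | outside m≢a m≢1+a rewrite swap-outside m≢a m≢1+a = m≤b

swap->  : ∀ {a m b} → b < m → a ≢ b → b < swap a m
swap->  {a} {m} b<m a≢b with position a m
... | at    rewrite swap-at a    = ℕₚ.<-trans b<m (ℕₚ.n<1+n a)
... | above rewrite swap-above a = ℕₚ.≤∧≢⇒< (ℕₚ.≤-pred b<m) (λ b≡a → a≢b (sym b≡a))
... | outside m≢a m≢1+a rewrite swap-outside m≢a m≢1+a = b<m

swap-pivot-nonzero : ∀ c m → 1 ≤ swap (pivot c) (suc m)
swap-pivot-nonzero zero    m rewrite swap-suc 0 m = s≤s z≤n
swap-pivot-nonzero (suc i) m rewrite swap-suc i m = s≤s z≤n

t-zero : ∀ c → t c (+ 0) ≡ + 0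
t-zero zero    = refl
t-zero (suc c) = refl

∣t∣ : ∀ c z → ∣ t c z ∣ ≡ swap (pivot c) ∣ z ∣
∣t∣ c z = trans (cong ∣_∣ (t-signAbs c z)) (ℤₚ.abs-◃ _ _)

sign-t : ∀ c z → 1 ≤ ∣ z ∣ → sign (t c z) ≡ sign z Sign.* flip c ∣ z ∣
sign-t c z 1≤∣z∣ with ∣ z ∣ in eq
... | suc m = trans (cong sign (trans (t-signAbs c z) (cong (λ k → (sign z Sign.* flip c k) ◃ swap (pivot c) k) eq)))
                    (ℤₚ.sign-◃ _ (swap (pivot c) (suc m)) {{ℕ.>-nonZero (swap-pivot-nonzero c m)}})

t-odd : ∀ c z → t c (- z) ≡ - t c z
t-odd c (+ zero)  = trans (t-zero c) (cong -_ (sym (t-zero c)))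
t-odd c (+ suc m) = trans (t-signAbs c -[1+ m ]) (sym (trans (cong -_ (t-signAbs c (+ suc m))) (neg-◃ _ _)))
t-odd c -[1+ m ]  = trans (t-signAbs c (+ suc m)) (sym (begin
  - t c -[1+ m ]                                    ≡⟨ cong -_ (t-signAbs c -[1+ m ]) ⟩
  - (opposite f ◃ swap (pivot c) (suc m))            ≡⟨ neg-◃ _ _ ⟩
  opposite (opposite f) ◃ swap (pivot c) (suc m)     ≡⟨ cong (_◃ swap (pivot c) (suc m)) (Signₚ.opposite-involutive f) ⟩
  f ◃ swap (pivot c) (suc m)                         ∎))
  where
  open ≡-Reasoning
  f : Sign
  f = flip c (suc m)

flip-outside : ∀ c {m} → m ≢ pivot c → m ≢ suc (pivot c) → flip c m ≡ Sign.+
flip-outside zero    m≢1 m≢2 rewrite ≢⇒≡ᵇ≡false m≢1 | ≢⇒≡ᵇ≡false m≢2 = refl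
flip-outside (suc i) _   _   = refl

t-outside : ∀ c z → ∣ z ∣ ≢ pivot c → ∣ z ∣ ≢ suc (pivot c) → t c z ≡ z
t-outside c z p q = begin
  t c z                                               ≡⟨ t-signAbs c z ⟩
  (sign z Sign.* flip c ∣ z ∣) ◃ swap (pivot c) ∣ z ∣  ≡⟨ cong₂ (λ f m → (sign z Sign.* f) ◃ m) (flip-outside c p q) (swap-outside p q) ⟩
  (sign z Sign.* Sign.+) ◃ ∣ z ∣                       ≡⟨ cong (_◃ ∣ z ∣) (Signₚ.*-identityʳ (sign z)) ⟩
  sign z ◃ ∣ z ∣                                      ≡⟨ ℤₚ.◃-inverse z ⟩
  z                                                   ∎
  where open ≡-Reasoning

-- Inversion status

-- For positions a < b the reflection r(a,b,σ) of 𝔇_n sends v(a) to σ·v(b);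
-- v has this reflection as an inversion iff v(a) > v(b) (σ = +), resp.
-- v(a) + v(b) < 0 (σ = -).  Read off from signs and absolute values, the
-- inversion status is Sign.- exactly for inversions.
status : Sign → Sign → ℕ → Sign → ℕ → Sign
status σ s₁ m₁ s₂ m₂ = if m₁ <ᵇ m₂ then s₂ else opposite (σ Sign.* s₁)

Exchange : Sign → Sign → Sign → Sign → Set
Exchange σ f s₁ s₂ = (s₁ Sign.* f ≡ σ Sign.* s₂) × (s₂ Sign.* f ≡ σ Sign.* s₁)

≢-opposite⇒≡ : ∀ {s r} → s ≢ opposite r → s ≡ r
≢-opposite⇒≡ {Sign.+} {Sign.+} _ = refl
≢-opposite⇒≡ {Sign.-} {Sign.-} _ = refl
≢-opposite⇒≡ {Sign.+} {Sign.-} h = ⊥-elim (h refl)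
≢-opposite⇒≡ {Sign.-} {Sign.+} h = ⊥-elim (h refl)

exchange-canonical : ∀ σ f s → Exchange σ f s (σ Sign.* (s Sign.* f))
exchange-canonical Sign.+ Sign.+ Sign.+ = refl , refl
exchange-canonical Sign.+ Sign.+ Sign.- = refl , refl
exchange-canonical Sign.+ Sign.- Sign.+ = refl , refl
exchange-canonical Sign.+ Sign.- Sign.- = refl , refl
exchange-canonical Sign.- Sign.+ Sign.+ = refl , refl
exchange-canonical Sign.- Sign.+ Sign.- = refl , refl
exchange-canonical Sign.- Sign.- Sign.+ = refl , refl
exchange-canonical Sign.- Sign.- Sign.- = refl , refl

exchange : ∀ σ f s₁ s₂ → s₂ ≢ opposite (σ Sign.* (s₁ Sign.* f)) → Exchange σ f s₁ s₂
exchange σ f s₁ s₂ h with ≢-opposite⇒≡ h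
... | refl = exchange-canonical σ f s₁

exchange-sym : ∀ {σ f s₁ s₂} → Exchange σ f s₁ s₂ → Exchange σ f s₂ s₁
exchange-sym (e₁ , e₂) = e₂ , e₁

opposite-conj : ∀ σ s r → s ≡ opposite (σ Sign.* r) → r ≡ opposite (σ Sign.* s)
opposite-conj Sign.+ _ Sign.+ refl = refl
opposite-conj Sign.+ _ Sign.- refl = refl
opposite-conj Sign.- _ Sign.+ refl = refl
opposite-conj Sign.- _ Sign.- refl = refl

swap-<ᵇˡ : ∀ {a m k} → k ≢ a → k ≢ suc a → (swap a m <ᵇ k) ≡ (m <ᵇ k)
swap-<ᵇˡ {a} {m} k≢a k≢1+a with position a m
... | at    rewrite swap-at a    = suc-<ᵇ k≢1+a
... | above rewrite swap-above a = sym (suc-<ᵇ k≢1+a)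
... | outside m≢a m≢1+a rewrite swap-outside m≢a m≢1+a = refl

<ᵇ-swapʳ : ∀ {a m k} → m ≢ a → m ≢ suc a → (m <ᵇ swap a k) ≡ (m <ᵇ k)
<ᵇ-swapʳ {a} {m} {k} m≢a m≢1+a with position a k
... | at    rewrite swap-at a    = <ᵇ-suc m≢a
... | above rewrite swap-above a = sym (<ᵇ-suc m≢a)
... | outside k≢a k≢1+a rewrite swap-outside k≢a k≢1+a = refl

swap-status-change : ∀ a σ s₁ m₁ s₂ m₂ → m₁ ≢ m₂ →
  status σ (s₁ Sign.* Sign.+) (swap a m₁) (s₂ Sign.* Sign.+) (swap a m₂) ≢ status σ s₁ m₁ s₂ m₂ →
  swap a m₁ ≡ m₂ × Exchange σ Sign.+ s₁ s₂
swap-status-change a σ s₁ m₁ s₂ m₂ m₁≢m₂ changed with position a m₁ | position a m₂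
... | at    | at    = ⊥-elim (m₁≢m₂ refl)
... | above | above = ⊥-elim (m₁≢m₂ refl)
... | at    | above
  rewrite swap-at a | swap-above a | ≮⇒<ᵇ≡false (ℕₚ.<-asym (ℕₚ.n<1+n a)) | <⇒<ᵇ≡true (ℕₚ.n<1+n a)
  = refl , exchange σ Sign.+ s₁ s₂ (λ e → changed (sym e))
... | above | at
  rewrite swap-at a | swap-above a | ≮⇒<ᵇ≡false (ℕₚ.<-asym (ℕₚ.n<1+n a)) | <⇒<ᵇ≡true (ℕₚ.n<1+n a)
  = refl , exchange-sym {σ} {Sign.+} {s₂} (exchange σ Sign.+ s₂ s₁ (λ e → changed (opposite-conj σ s₁ _ e)))
... | outside m₁≢a m₁≢1+a | _
  rewrite swap-outside m₁≢a m₁≢1+a | <ᵇ-swapʳ {k = m₂} m₁≢a m₁≢1+a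
        | Signₚ.*-identityʳ s₁ | Signₚ.*-identityʳ s₂ = ⊥-elim (changed refl)
... | _ | outside m₂≢a m₂≢1+a
  rewrite swap-outside m₂≢a m₂≢1+a | swap-<ᵇˡ {m = m₁} m₂≢a m₂≢1+a
        | Signₚ.*-identityʳ s₁ | Signₚ.*-identityʳ s₂ = ⊥-elim (changed refl)

t-status-change : ∀ c σ s₁ m₁ s₂ m₂ → 1 ≤ m₁ → 1 ≤ m₂ → m₁ ≢ m₂ →
  status σ (s₁ Sign.* flip c m₁) (swap (pivot c) m₁) (s₂ Sign.* flip c m₂) (swap (pivot c) m₂)
    ≢ status σ s₁ m₁ s₂ m₂ →
  swap (pivot c) m₁ ≡ m₂ × (s₁ Sign.* flip c m₁ ≡ σ Sign.* s₂) × (s₂ Sign.* flip c m₂ ≡ σ Sign.* s₁)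
t-status-change (suc i) σ s₁ m₁ s₂ m₂ _ _ m₁≢m₂ changed =
  swap-status-change (suc i) σ s₁ m₁ s₂ m₂ m₁≢m₂ changed
t-status-change zero σ s₁ 1 s₂ 2 _ _ _ changed =
  refl , exchange σ Sign.- s₁ s₂ (λ e → changed (sym e))
t-status-change zero σ s₁ 2 s₂ 1 _ _ _ changed =
  refl , exchange-sym {σ} {Sign.-} {s₂} (exchange σ Sign.- s₂ s₁ (λ e → changed (opposite-conj σ s₁ _ e)))
t-status-change zero σ s₁ 1 s₂ 1 _ _ m₁≢m₂ _ = ⊥-elim (m₁≢m₂ refl)
t-status-change zero σ s₁ 2 s₂ 2 _ _ m₁≢m₂ _ = ⊥-elim (m₁≢m₂ refl)
t-status-change zero σ s₁ 1 s₂ (suc (suc (suc _))) _ _ _ changed = ⊥-elim (changed (Signₚ.*-identityʳ s₂))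
t-status-change zero σ s₁ 2 s₂ (suc (suc (suc _))) _ _ _ changed = ⊥-elim (changed (Signₚ.*-identityʳ s₂))
t-status-change zero σ s₁ (suc (suc (suc _))) s₂ 1 _ _ _ changed =
  ⊥-elim (changed (cong (λ s → opposite (σ Sign.* s)) (Signₚ.*-identityʳ s₁)))
t-status-change zero σ s₁ (suc (suc (suc _))) s₂ 2 _ _ _ changed =
  ⊥-elim (changed (cong (λ s → opposite (σ Sign.* s)) (Signₚ.*-identityʳ s₁)))
t-status-change zero σ s₁ (suc (suc (suc _))) s₂ (suc (suc (suc _))) _ _ _ changed
  rewrite Signₚ.*-identityʳ s₁ | Signₚ.*-identityʳ s₂ = ⊥-elim (changed refl)

_·_ : Sign → ℤ → ℤ
Sign.+ · z = z
Sign.- · z = - z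

∣·∣ : ∀ σ z → ∣ σ · z ∣ ≡ ∣ z ∣
∣·∣ Sign.+ z = refl
∣·∣ Sign.- z = ℤₚ.∣-i∣≡∣i∣ z

signAbs-· : ∀ σ z → (σ Sign.* sign z) ◃ ∣ z ∣ ≡ σ · z
signAbs-· Sign.+ z = ℤₚ.◃-inverse z
signAbs-· Sign.- z = trans (sym (neg-◃ (sign z) ∣ z ∣)) (cong -_ (ℤₚ.◃-inverse z))

statusℤ : Sign → ℤ → ℤ → Sign
statusℤ σ x y = status σ (sign x) (∣ x ∣) (sign y) (∣ y ∣)

statusℤ-t : ∀ c σ x y → 1 ≤ ∣ x ∣ → 1 ≤ ∣ y ∣ →
  statusℤ σ (t c x) (t c y) ≡ status σ (sign x Sign.* flip c ∣ x ∣) (swap (pivot c) ∣ x ∣)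
                                       (sign y Sign.* flip c ∣ y ∣) (swap (pivot c) ∣ y ∣)
statusℤ-t c σ x y 1≤∣x∣ 1≤∣y∣
  rewrite sign-t c x 1≤∣x∣ | sign-t c y 1≤∣y∣ | ∣t∣ c x | ∣t∣ c y = refl

t-statusℤ-change : ∀ c σ x y → 1 ≤ ∣ x ∣ → 1 ≤ ∣ y ∣ → ∣ x ∣ ≢ ∣ y ∣ →
              statusℤ σ (t c x) (t c y) ≢ statusℤ σ x y → t c x ≡ σ · y × t c y ≡ σ · x
t-statusℤ-change c σ x y 1≤∣x∣ 1≤∣y∣ ∣x∣≢∣y∣ changed
  with swapped , sx , sy ← t-status-change c σ (sign x) (∣ x ∣) (sign y) (∣ y ∣) 1≤∣x∣ 1≤∣y∣ ∣x∣≢∣y∣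
                             (λ e → changed (trans (statusℤ-t c σ x y 1≤∣x∣ 1≤∣y∣) e))
  = image x y swapped sx , image y x (trans (cong (swap (pivot c)) (sym swapped)) (swap-involutive (pivot c) ∣ x ∣)) sy
  where
  image : ∀ z w → swap (pivot c) ∣ z ∣ ≡ ∣ w ∣ → sign z Sign.* flip c ∣ z ∣ ≡ σ Sign.* sign w →
          t c z ≡ σ · w
  image z w ∣tz∣ stz = trans (t-signAbs c z) (trans (cong₂ _◃_ stz ∣tz∣) (signAbs-· σ w))

-- Windows

lookup-map : ∀ {n} (f : ℤ → ℤ) → f (+ 0) ≡ + 0 → (v : Vec ℤ n) (k : ℕ) →
             lookupℕ (map f v) k ≡ f (lookupℕ v k)
lookup-map f f0 []       k       = sym f0
lookup-map f f0 (x ∷ v) zero    = refl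
lookup-map f f0 (x ∷ v) (suc k) = lookup-map f f0 v k

lookup-tabulate : ∀ {n} (g : ℕ → ℤ) k → k < n → lookupℕ (tabulate {n = n} (λ i → g (toℕ i))) k ≡ g k
lookup-tabulate {suc n} g zero    _         = refl
lookup-tabulate {suc n} g (suc k) (s≤s k<n) = lookup-tabulate (λ j → g (suc j)) k k<n

lookup-ext : ∀ {n} (u v : Vec ℤ n) → (∀ k → k < n → lookupℕ u k ≡ lookupℕ v k) → u ≡ v
lookup-ext []       []       _  = refl
lookup-ext (x ∷ u) (y ∷ v) eq =
  cong₂ _∷_ (eq zero (s≤s z≤n)) (lookup-ext u v (λ k k<n → eq (suc k) (s≤s k<n)))

lookup-idW : ∀ n k → k < n → lookupℕ (idW n) k ≡ + suc k
lookup-idW n = lookup-tabulate (λ j → + suc j)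

record SignedPerm {n} (v : Vec ℤ n) : Set where
  field
    nonzero        : ∀ k → k < n → 1 ≤ ∣ lookupℕ v k ∣
    abs-injective  : ∀ k l → k < n → l < n → ∣ lookupℕ v k ∣ ≡ ∣ lookupℕ v l ∣ → k ≡ l
    abs-surjective : ∀ m → 1 ≤ m → m ≤ n → ∃ λ k → k < n × ∣ lookupℕ v k ∣ ≡ m

signedPerm-idW : ∀ n → SignedPerm (idW n)
signedPerm-idW n = record
  { nonzero        = λ k k<n → subst (λ z → 1 ≤ ∣ z ∣) (sym (lookup-idW n k k<n)) (s≤s z≤n)
  ; abs-injective  = λ k l k<n l<n eq → ℕₚ.suc-injective
      (trans (cong ∣_∣ (sym (lookup-idW n k k<n))) (trans eq (cong ∣_∣ (lookup-idW n l l<n))))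
  ; abs-surjective = λ { (suc m) _ m<n → m , m<n , cong ∣_∣ (lookup-idW n m m<n) }
  }

pivot-bound : ∀ c n → c < n → 2 ≤ n → suc (pivot c) ≤ n
pivot-bound zero    n _   2≤n = 2≤n
pivot-bound (suc c) n c<n _   = c<n

signedPerm-t : ∀ {n} c (v : Vec ℤ n) → c < n → 2 ≤ n → SignedPerm v → SignedPerm (map (t c) v)
signedPerm-t {n} c v c<n 2≤n sp = record
  { nonzero        = λ k k<n → subst (1 ≤_) (sym (∣tv∣ k)) (nonzero′ k k<n)
  ; abs-injective  = λ k l k<n l<n eq → abs-injective k l k<n l<n
      (trans (sym (swap-involutive a _)) (trans (cong (swap a) (trans (sym (∣tv∣ k)) (trans eq (∣tv∣ l))))
             (swap-involutive a _)))
  ; abs-surjective = surjective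
  }
  where
  open SignedPerm sp
  a : ℕ
  a = pivot c
  ∣tv∣ : ∀ k → ∣ lookupℕ (map (t c) v) k ∣ ≡ swap a ∣ lookupℕ v k ∣
  ∣tv∣ k = trans (cong ∣_∣ (lookup-map (t c) (t-zero c) v k)) (∣t∣ c (lookupℕ v k))
  nonzero′ : ∀ k → k < n → 1 ≤ swap a ∣ lookupℕ v k ∣
  nonzero′ k k<n with ∣ lookupℕ v k ∣ | nonzero k k<n
  ... | suc m | _ = swap-pivot-nonzero c m
  surjective : ∀ m → 1 ≤ m → m ≤ n → ∃ λ k → k < n × ∣ lookupℕ (map (t c) v) k ∣ ≡ m
  surjective (suc m) _ m≤n
    with k , k<n , eq ← abs-surjective (swap a (suc m)) (swap-pivot-nonzero c m)
                                        (swap-≤ m≤n (ℕₚ.<⇒≢ (pivot-bound c n c<n 2≤n)))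
    = k , k<n , trans (∣tv∣ k) (trans (cong (swap a) eq) (swap-involutive a (suc m)))

signedPerm-eval : ∀ {n} → 2 ≤ n → (w : List (Fin n)) → SignedPerm (eval w)
signedPerm-eval {n} 2≤n []      = signedPerm-idW n
signedPerm-eval 2≤n (c ∷ w) = signedPerm-t (toℕ c) (eval w) (Finₚ.toℕ<n c) 2≤n (signedPerm-eval 2≤n w)

act : ∀ {n} → List (Fin n) → Vec ℤ n → Vec ℤ n
act []      v = v
act (c ∷ w) v = map (t (toℕ c)) (act w v)

eval-++ : ∀ {n} (xs ys : List (Fin n)) → eval (xs ++ ys) ≡ act xs (eval ys)
eval-++ []       ys = refl
eval-++ (c ∷ xs) ys = cong (map (t (toℕ c))) (eval-++ xs ys)

reflect-entry : ∀ {n} → ℕ → ℕ → Sign → Vec ℤ n → ℕ → ℤ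
reflect-entry a b σ v k = if k ≡ᵇ a then σ · lookupℕ v b else if k ≡ᵇ b then σ · lookupℕ v a else lookupℕ v k

-- v ∘ r(a,b,σ): the window of v multiplied on the right by a reflection
reflect : ∀ {n} → ℕ → ℕ → Sign → Vec ℤ n → Vec ℤ n
reflect a b σ v = tabulate (λ i → reflect-entry a b σ v (toℕ i))

lookup-reflect : ∀ {n} a b σ (v : Vec ℤ n) k → k < n → lookupℕ (reflect a b σ v) k ≡ reflect-entry a b σ v k
lookup-reflect a b σ v = lookup-tabulate (reflect-entry a b σ v)

·-odd : ∀ (f : ℤ → ℤ) → (∀ z → f (- z) ≡ - f z) → ∀ σ z → f (σ · z) ≡ σ · f z
·-odd f f-odd Sign.+ z = refl
·-odd f f-odd Sign.- z = f-odd z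

·-involutive : ∀ σ z → σ · (σ · z) ≡ z
·-involutive Sign.+ z = refl
·-involutive Sign.- z = ℤₚ.neg-involutive z

map-reflect : ∀ {n} (f : ℤ → ℤ) → f (+ 0) ≡ + 0 → (∀ z → f (- z) ≡ - f z) →
              ∀ a b σ (v : Vec ℤ n) → map f (reflect a b σ v) ≡ reflect a b σ (map f v)
map-reflect f f0 f-odd a b σ v = lookup-ext _ _ λ k k<n → begin
  lookupℕ (map f (reflect a b σ v)) k  ≡⟨ lookup-map f f0 (reflect a b σ v) k ⟩
  f (lookupℕ (reflect a b σ v) k)      ≡⟨ cong f (lookup-reflect a b σ v k k<n) ⟩
  f (reflect-entry a b σ v k)          ≡⟨ f-entry k ⟩
  reflect-entry a b σ (map f v) k      ≡⟨ lookup-reflect a b σ (map f v) k k<n ⟨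
  lookupℕ (reflect a b σ (map f v)) k  ∎
  where
  open ≡-Reasoning
  f-entry : ∀ k → f (reflect-entry a b σ v k) ≡ reflect-entry a b σ (map f v) k
  f-entry k with k ≡ᵇ a | k ≡ᵇ b
  ... | true  | _     = trans (·-odd f f-odd σ _) (cong (σ ·_) (sym (lookup-map f f0 v b)))
  ... | false | true  = trans (·-odd f f-odd σ _) (cong (σ ·_) (sym (lookup-map f f0 v a)))
  ... | false | false = sym (lookup-map f f0 v k)

act-reflect : ∀ {n} (xs : List (Fin n)) a b σ v → act xs (reflect a b σ v) ≡ reflect a b σ (act xs v)
act-reflect []       a b σ v = refl
act-reflect (c ∷ xs) a b σ v = trans (cong (map (t (toℕ c))) (act-reflect xs a b σ v))
  (map-reflect (t (toℕ c)) (t-zero (toℕ c)) (t-odd (toℕ c)) a b σ (act xs v))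

reflect-involutive : ∀ {n} a b σ (v : Vec ℤ n) → a < n → b < n → a ≢ b →
                     reflect a b σ (reflect a b σ v) ≡ v
reflect-involutive {n} a b σ v a<n b<n a≢b = lookup-ext _ _ λ k k<n →
  trans (lookup-reflect a b σ (reflect a b σ v) k k<n) (entry-involutive k k<n)
  where
  r : ∀ k → k < n → lookupℕ (reflect a b σ v) k ≡ reflect-entry a b σ v k
  r = lookup-reflect a b σ v
  entry-involutive : ∀ k → k < n → reflect-entry a b σ (reflect a b σ v) k ≡ lookupℕ v k
  entry-involutive k k<n with k ≡ᵇ a in k≡a | k ≡ᵇ b in k≡b
  ... | true | _
    rewrite r b b<n | ≢⇒≡ᵇ≡false (λ e → a≢b (sym e)) | ≡ᵇ-refl b
    = trans (·-involutive σ _) (cong (lookupℕ v) (sym (≡ᵇ⇒≡ k≡a)))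
  ... | false | true
    rewrite r a a<n | ≡ᵇ-refl a = trans (·-involutive σ _) (cong (lookupℕ v) (sym (≡ᵇ⇒≡ k≡b)))
  ... | false | false
    rewrite r k k<n | k≡a | k≡b = refl

swap-moved⇒outside : ∀ {a m₁ m} → swap a m₁ ≢ m₁ → m ≢ m₁ → m ≢ swap a m₁ → m ≢ a × m ≢ suc a
swap-moved⇒outside {a} {m₁} moved m≢m₁ m≢swap with position a m₁
... | at    rewrite swap-at a    = m≢m₁ , m≢swap
... | above rewrite swap-above a = m≢swap , m≢m₁
... | outside m₁≢a m₁≢1+a = ⊥-elim (moved (swap-outside m₁≢a m₁≢1+a))

Inversion : ∀ {n} → Vec ℤ n → ℕ → ℕ → Sign → Set
Inversion v a b σ = statusℤ σ (lookupℕ v a) (lookupℕ v b) ≡ Sign.-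

t-status-change⇒reflect : ∀ {n} c σ a b (v : Vec ℤ n) → SignedPerm v → a < b → b < n →
  statusℤ σ (lookupℕ (map (t c) v) a) (lookupℕ (map (t c) v) b) ≢ statusℤ σ (lookupℕ v a) (lookupℕ v b) →
  map (t c) v ≡ reflect a b σ v
t-status-change⇒reflect {n} c σ a b v sp a<b b<n changed = lookup-ext _ _ λ k k<n →
  trans (lookup-map (t c) (t-zero c) v k) (trans (entry k k<n) (sym (lookup-reflect a b σ v k k<n)))
  where
  open SignedPerm sp
  a<n : a < n
  a<n = ℕₚ.<-trans a<b b<n
  x y : ℤ
  x = lookupℕ v a
  y = lookupℕ v b
  tv : ∀ k → lookupℕ (map (t c) v) k ≡ t c (lookupℕ v k)
  tv = lookup-map (t c) (t-zero c) v
  ∣x∣≢∣y∣ : ∣ x ∣ ≢ ∣ y ∣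
  ∣x∣≢∣y∣ eq = ℕₚ.<⇒≢ a<b (abs-injective a b a<n b<n eq)
  exchanged : t c x ≡ σ · y × t c y ≡ σ · x
  exchanged = t-statusℤ-change c σ x y (nonzero a a<n) (nonzero b b<n) ∣x∣≢∣y∣
                (λ eq → changed (trans (cong₂ (statusℤ σ) (tv a) (tv b)) eq))
  ∣y∣≡swap∣x∣ : ∣ y ∣ ≡ swap (pivot c) ∣ x ∣
  ∣y∣≡swap∣x∣ = trans (sym (∣·∣ σ y)) (trans (cong ∣_∣ (sym (proj₁ exchanged))) (∣t∣ c x))
  entry : ∀ k → k < n → t c (lookupℕ v k) ≡ reflect-entry a b σ v k
  entry k k<n with k ≡ᵇ a in k≡a | k ≡ᵇ b in k≡b
  ... | true  | _    = trans (cong (λ j → t c (lookupℕ v j)) (≡ᵇ⇒≡ k≡a)) (proj₁ exchanged)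
  ... | false | true = trans (cong (λ j → t c (lookupℕ v j)) (≡ᵇ⇒≡ k≡b)) (proj₂ exchanged)
  ... | false | false = uncurry (t-outside c (lookupℕ v k)) (swap-moved⇒outside
        (λ e → ∣x∣≢∣y∣ (sym (trans ∣y∣≡swap∣x∣ e)))
        (λ e → ≡ᵇ≡false⇒≢ k≡a (abs-injective k a k<n a<n e))
        (λ e → ≡ᵇ≡false⇒≢ k≡b (abs-injective k b k<n b<n (trans e (sym ∣y∣≡swap∣x∣)))))

-- The deletion condition

inversion? : ∀ {n} (v : Vec ℤ n) a b σ → Dec (Inversion v a b σ)
inversion? v a b σ = statusℤ σ (lookupℕ v a) (lookupℕ v b) Signₚ.≟ Sign.-

¬inversion-idW : ∀ n a b σ → a < b → b < n → ¬ Inversion (idW n) a b σ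
¬inversion-idW n a b σ a<b b<n
  rewrite lookup-idW n a (ℕₚ.<-trans a<b b<n) | lookup-idW n b b<n | <⇒<ᵇ≡true (s≤s a<b) = λ ()

inversion-origin : ∀ {n} → 2 ≤ n → (ys : List (Fin n)) → ∀ a b σ → a < b → b < n → Inversion (eval ys) a b σ →
  ∃ λ ys₁ → ∃₂ λ d ys₂ → ys ≡ ys₁ ++ d ∷ ys₂ × map (t (toℕ d)) (eval ys₂) ≡ reflect a b σ (eval ys₂)
inversion-origin {n} 2≤n [] a b σ a<b b<n inv = ⊥-elim (¬inversion-idW n a b σ a<b b<n inv)
inversion-origin 2≤n (d ∷ ys) a b σ a<b b<n inv with inversion? (eval ys) a b σ
... | yes inv′ with ys₁ , d′ , ys₂ , refl , reflects ← inversion-origin 2≤n ys a b σ a<b b<n inv′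
  = d ∷ ys₁ , d′ , ys₂ , refl , reflects
... | no ¬inv′ = [] , d , ys , refl ,
  t-status-change⇒reflect (toℕ d) σ a b (eval ys) (signedPerm-eval 2≤n ys) a<b b<n (λ e → ¬inv′ (trans (sym e) inv))

-- Two letters that produce the same reflection cancel.
deletion : ∀ {n} c d σ a b (ys₁ ys₂ : List (Fin n)) → a < b → b < n →
  map (t (toℕ c)) (eval (ys₁ ++ d ∷ ys₂)) ≡ reflect a b σ (eval (ys₁ ++ d ∷ ys₂)) →
  map (t (toℕ d)) (eval ys₂) ≡ reflect a b σ (eval ys₂) →
  eval (c ∷ ys₁ ++ d ∷ ys₂) ≡ eval (ys₁ ++ ys₂)
deletion c d σ a b ys₁ ys₂ a<b b<n c-reflects d-reflects = begin
  map (t (toℕ c)) (eval (ys₁ ++ d ∷ ys₂))       ≡⟨ c-reflects ⟩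
  reflect a b σ (eval (ys₁ ++ d ∷ ys₂))          ≡⟨ cong (reflect a b σ) (eval-++ ys₁ (d ∷ ys₂)) ⟩
  reflect a b σ (act ys₁ (map (t (toℕ d)) (eval ys₂)))   ≡⟨ cong (λ v → reflect a b σ (act ys₁ v)) d-reflects ⟩
  reflect a b σ (act ys₁ (reflect a b σ (eval ys₂)))     ≡⟨ cong (reflect a b σ) (act-reflect ys₁ a b σ (eval ys₂)) ⟩
  reflect a b σ (reflect a b σ (act ys₁ (eval ys₂)))     ≡⟨ reflect-involutive a b σ _ (ℕₚ.<-trans a<b b<n) b<n (ℕₚ.<⇒≢ a<b) ⟩
  act ys₁ (eval ys₂)                             ≡⟨ eval-++ ys₁ ys₂ ⟨
  eval (ys₁ ++ ys₂)                              ∎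
  where open ≡-Reasoning

length-deletion : ∀ {A : Set} (xs ys₁ ys₂ : List A) c d →
                  length (xs ++ ys₁ ++ ys₂) < length (xs ++ c ∷ ys₁ ++ d ∷ ys₂)
length-deletion xs ys₁ ys₂ c d
  rewrite Listₚ.length-++ xs {ys₁ ++ ys₂} | Listₚ.length-++ xs {c ∷ ys₁ ++ d ∷ ys₂}
        | Listₚ.length-++ ys₁ {ys₂} | Listₚ.length-++ ys₁ {d ∷ ys₂}
  = ℕₚ.+-monoʳ-< (length xs) (s≤s (ℕₚ.+-monoʳ-≤ (length ys₁) (ℕₚ.n≤1+n (length ys₂))))

reduced-keeps-inversion : ∀ {n} → 2 ≤ n → (u : Vec ℤ n) (xs ys : List (Fin n)) (c : Fin n) →
  Reduced u (xs ++ c ∷ ys) →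
  ∀ a b σ → a < b → b < n → Inversion (eval ys) a b σ → Inversion (eval (c ∷ ys)) a b σ
reduced-keeps-inversion 2≤n u xs ys c (evals , minimal) a b σ a<b b<n inv
  with inversion? (eval (c ∷ ys)) a b σ
... | yes inv′ = inv′
... | no ¬inv′
  with ys₁ , d , ys₂ , refl , d-reflects ← inversion-origin 2≤n ys a b σ a<b b<n inv
  = ⊥-elim (ℕₚ.<⇒≱ (length-deletion xs ys₁ ys₂ c d) (minimal (xs ++ ys₁ ++ ys₂) shorter-evals))
  where
  c-reflects : map (t (toℕ c)) (eval ys) ≡ reflect a b σ (eval ys)
  c-reflects = t-status-change⇒reflect (toℕ c) σ a b (eval ys) (signedPerm-eval 2≤n ys) a<b b<n
                 (λ e → ¬inv′ (trans e inv))
  shorter-evals : eval (xs ++ ys₁ ++ ys₂) ≡ u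
  shorter-evals = begin
    eval (xs ++ ys₁ ++ ys₂)           ≡⟨ eval-++ xs (ys₁ ++ ys₂) ⟩
    act xs (eval (ys₁ ++ ys₂))        ≡⟨ cong (act xs) (deletion c d σ a b ys₁ ys₂ a<b b<n c-reflects d-reflects) ⟨
    act xs (eval (c ∷ ys₁ ++ d ∷ ys₂)) ≡⟨ eval-++ xs (c ∷ ys₁ ++ d ∷ ys₂) ⟨
    eval (xs ++ c ∷ ys₁ ++ d ∷ ys₂)   ≡⟨ evals ⟩
    u                                 ∎
    where open ≡-Reasoning

reduced-inversion-persists : ∀ {n} → 2 ≤ n → (u : Vec ℤ n) (zs ys : List (Fin n)) → Reduced u (zs ++ ys) →
  ∀ a b σ → a < b → b < n → Inversion (eval ys) a b σ → Inversion u a b σ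
reduced-inversion-persists 2≤n u zs ys red a b σ a<b b<n inv =
  subst (λ v → Inversion v a b σ) (proj₁ red) (go [] zs refl)
  where
  go : ∀ xs zs′ → xs ++ zs′ ++ ys ≡ zs ++ ys → Inversion (eval (zs′ ++ ys)) a b σ
  go xs []        _  = inv
  go xs (z ∷ zs′) eq = reduced-keeps-inversion 2≤n u xs (zs′ ++ ys) z (subst (Reduced u) (sym eq) red) a b σ a<b b<n
    (go (xs ++ z ∷ []) zs′ (trans (Listₚ.++-assoc xs (z ∷ []) (zs′ ++ ys)) eq))

-- Reduced words

words-of-length? : ∀ {n} L (Q : List (Fin n) → Set) → Decidable Q → Dec (∃ λ w → length w ≡ L × Q w)
words-of-length? zero Q Q? with Q? []
... | yes q  = yes ([] , refl , q)
... | no ¬q = no λ { ([] , _ , q) → ¬q q ; (_ ∷ _ , () , _) }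
words-of-length? (suc L) Q Q? with Finₚ.any? (λ c → words-of-length? L (λ w → Q (c ∷ w)) (λ w → Q? (c ∷ w)))
... | yes (c , w , refl , q) = yes (c ∷ w , refl , q)
... | no ¬q = no λ { ([] , () , _) ; (c ∷ w , refl , q) → ¬q (c , w , refl , q) }

reduced-exists : ∀ {n} (u : Vec ℤ n) → InD u → ∃ λ w → Reduced u w
reduced-exists u (w₀ , evals) = shortest (least-witness Spells spells? (w₀ , refl , evals))
  where
  Spells : ℕ → Set
  Spells L = ∃ λ w → length w ≡ L × eval w ≡ u
  spells? : Decidable Spells
  spells? L = words-of-length? L (λ w → eval w ≡ u) (λ w → Vecₚ.≡-dec ℤ._≟_ (eval w) u)
  shortest : (∃ λ L → Spells L × (∀ k → k < L → ¬ Spells k)) → ∃ λ w → Reduced u w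
  shortest (_ , (w , refl , w-evals) , minimal) =
    w , w-evals , λ w′ w′-evals → ℕₚ.≮⇒≥ (λ shorter → minimal (length w′) shorter (w′ , refl , w′-evals))

avoiding-word : ∀ {n} (u : Vec ℤ n) (i : Fin n) → InD u → InC u i → ∃ λ w → eval w ≡ u × i ∉ w
avoiding-word u i u∈D i∈C with w , red ← reduced-exists u u∈D = w , proj₁ red , λ i∈w → i∈C (w , red , i∈w)

eval-preserves : ∀ {n} (i : Fin n) (Pr : Vec ℤ n → Set) → Pr (idW n) →
  (∀ c v → c ≢ i → Pr v → Pr (map (t (toℕ c)) v)) → ∀ w → i ∉ w → Pr (eval w)
eval-preserves i Pr base step []      i∉w = base
eval-preserves i Pr base step (c ∷ w) i∉w =
  step c (eval w) (λ { refl → i∉w (here refl) }) (eval-preserves i Pr base step w (λ i∈w → i∉w (there i∈w)))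

C-preserves : ∀ {n} (u : Vec ℤ n) (i : Fin n) → InD u → InC u i → (Pr : Vec ℤ n → Set) → Pr (idW n) →
  (∀ c v → c ≢ i → Pr v → Pr (map (t (toℕ c)) v)) → Pr u
C-preserves u i u∈D i∈C Pr base step with w , evals , i∉w ← avoiding-word u i u∈D i∈C =
  subst Pr evals (eval-preserves i Pr base step w i∉w)

C-by-new-inversion : ∀ {n} → 2 ≤ n → (u : Vec ℤ n) (i : Fin n) →
  (∀ ys → i ∉ ys → ∃ λ a → ∃₂ λ b σ → a < b × b < n ×
     Inversion (map (t (toℕ i)) (eval ys)) a b σ × ¬ Inversion u a b σ) →
  InC u i
C-by-new-inversion 2≤n u i new (w , red , i∈w)
  with xs , ys , refl , i∉ys ← split-last Finₚ._≟_ i∈w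
  with a , b , σ , a<b , b<n , inv , ¬inv ← new ys i∉ys
  = ¬inv (reduced-inversion-persists 2≤n u xs (i ∷ ys) red a b σ a<b b<n inv)

-- The generator t₀

Positive : ∀ {n} → Vec ℤ n → Set
Positive {n} v = ∀ k → k < n → sign (lookupℕ v k) ≡ Sign.+

positive-idW : ∀ n → Positive (idW n)
positive-idW n k k<n rewrite lookup-idW n k k<n = refl

sign-t-suc : ∀ i z → sign z ≡ Sign.+ → sign (t (suc i) z) ≡ Sign.+
sign-t-suc i (+ m) _ rewrite t-signAbs (suc i) (+ m) | ℤₚ.+◃n≡+n (swap (suc i) m) = refl

positive-t : ∀ {n} (c : Fin (suc n)) (v : Vec ℤ (suc n)) → c ≢ Fin.zero → Positive v → Positive (map (t (toℕ c)) v)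
positive-t Fin.zero    v c≢0 _     = ⊥-elim (c≢0 refl)
positive-t (Fin.suc c) v _   v-pos k k<n
  rewrite lookup-map (t (suc (toℕ c))) refl v k = sign-t-suc (toℕ c) (lookupℕ v k) (v-pos k k<n)

positive-position : ∀ {n} (v : Vec ℤ n) → SignedPerm v → Positive v →
                    ∀ m → 1 ≤ m → m ≤ n → ∃ λ k → k < n × lookupℕ v k ≡ + m
positive-position v sp v-pos m 1≤m m≤n with k , k<n , ∣vk∣ ← SignedPerm.abs-surjective sp m 1≤m m≤n =
  k , k<n , ℤₚ.◃-cong (v-pos k k<n) ∣vk∣

positive-status : ∀ x y → sign x ≡ Sign.+ → sign y ≡ Sign.+ → statusℤ Sign.- x y ≡ Sign.+
positive-status (+ m) (+ k) _ _ with m <ᵇ k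
... | true  = refl
... | false = refl

¬inversion-of-+ : ∀ σ x y → statusℤ σ x y ≡ Sign.+ → statusℤ σ x y ≢ Sign.-
¬inversion-of-+ σ x y eq inv with () ← trans (sym eq) inv

¬inversion-positive : ∀ {n} (v : Vec ℤ n) → Positive v → ∀ a b → a < b → b < n → ¬ Inversion v a b Sign.-
¬inversion-positive v v-pos a b a<b b<n =
  ¬inversion-of-+ Sign.- (lookupℕ v a) (lookupℕ v b) (positive-status _ _ (v-pos a (ℕₚ.<-trans a<b b<n)) (v-pos b b<n))

C-zero⇒positive : ∀ {n} (u : Vec ℤ (suc n)) → InD u → InC u Fin.zero → Positive u
C-zero⇒positive {n} u u∈D 0∈C = C-preserves u Fin.zero u∈D 0∈C Positive (positive-idW (suc n)) positive-t

-- t₀ sends the values 1, 2 to -2, -1, an inversion of r(a,b,-).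
positive⇒C-zero : ∀ {n} → 2 ≤ suc n → (u : Vec ℤ (suc n)) → Positive u → InC u Fin.zero
positive⇒C-zero {n} 2≤n u u-pos = C-by-new-inversion 2≤n u Fin.zero new
  where
  new : ∀ ys → Fin.zero ∉ ys → ∃ λ a → ∃₂ λ b σ → a < b × b < suc n ×
          Inversion (map (t 0) (eval ys)) a b σ × ¬ Inversion u a b σ
  new ys 0∉ys = at-positions (positive-position v sp v-pos 1 (s≤s z≤n) (ℕₚ.<⇒≤ 2≤n))
                             (positive-position v sp v-pos 2 (s≤s z≤n) 2≤n)
    where
    v : Vec ℤ (suc n)
    v = eval ys
    sp : SignedPerm v
    sp = signedPerm-eval 2≤n ys
    v-pos : Positive v
    v-pos = eval-preserves Fin.zero Positive (positive-idW (suc n)) positive-t ys 0∉ys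
    tv : ∀ k → lookupℕ (map (t 0) v) k ≡ t 0 (lookupℕ v k)
    tv = lookup-map (t 0) refl v
    at-positions : (∃ λ p → p < suc n × lookupℕ v p ≡ + 1) → (∃ λ q → q < suc n × lookupℕ v q ≡ + 2) →
                   ∃ λ a → ∃₂ λ b σ → a < b × b < suc n × Inversion (map (t 0) v) a b σ × ¬ Inversion u a b σ
    at-positions (p , p<n , vp) (q , q<n , vq) with ℕₚ.<-cmp p q
    ... | tri< p<q _ _ = p , q , Sign.- , p<q , q<n , inv , ¬inversion-positive u u-pos p q p<q q<n
      where inv : Inversion (map (t 0) v) p q Sign.-
            inv rewrite tv p | tv q | vp | vq = refl
    ... | tri≈ _ refl _ with () ← trans (sym vp) vq
    ... | tri> _ _ q<p = q , p , Sign.- , q<p , p<n , inv , ¬inversion-positive u u-pos q p q<p p<n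
      where inv : Inversion (map (t 0) v) q p Sign.-
            inv rewrite tv p | tv q | vp | vq = refl

-- The generators tᵢ, i ≥ 2

Separated : ∀ {n} → ℕ → Vec ℤ n → Set
Separated {n} b v = ∀ k → k < n → (k < b → ∣ lookupℕ v k ∣ ≤ b) × (b ≤ k → + b ℤ.< lookupℕ v k)

separated-idW : ∀ n b → Separated b (idW n)
separated-idW n b k k<n rewrite lookup-idW n k k<n = (λ k<b → k<b) , (λ b≤k → ℤ.+<+ (s≤s b≤k))

pivot-≢ : ∀ {c b} → 2 ≤ b → c ≢ b → pivot c ≢ b
pivot-≢ {zero}  (s≤s ()) _ refl
pivot-≢ {suc c} _   c≢b = c≢b

flip-large : ∀ c m → 2 < m → flip c m ≡ Sign.+
flip-large zero    (suc (suc (suc m))) _                 = refl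
flip-large zero    (suc zero)          (s≤s ())
flip-large zero    (suc (suc zero))    (s≤s (s≤s ()))
flip-large (suc c) m                   _                 = refl

t-large : ∀ c m → 2 < m → t c (+ m) ≡ + swap (pivot c) m
t-large c m 2<m rewrite t-signAbs c (+ m) | flip-large c m 2<m = ℤₚ.+◃n≡+n (swap (pivot c) m)

separated-t : ∀ {n} (i : Fin n) → 2 ≤ toℕ i → (c : Fin n) (v : Vec ℤ n) →
              c ≢ i → Separated (toℕ i) v → Separated (toℕ i) (map (t (toℕ c)) v)
separated-t i 2≤b c v c≢i v-sep k k<n rewrite lookup-map (t (toℕ c)) (t-zero (toℕ c)) v k =
  low , high
  where
  b : ℕ
  b = toℕ i
  pivot≢b : pivot (toℕ c) ≢ b
  pivot≢b = pivot-≢ 2≤b (λ e → c≢i (Finₚ.toℕ-injective e))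
  low : k < b → ∣ t (toℕ c) (lookupℕ v k) ∣ ≤ b
  low k<b rewrite ∣t∣ (toℕ c) (lookupℕ v k) = swap-≤ (proj₁ (v-sep k k<n) k<b) pivot≢b
  high : b ≤ k → + b ℤ.< t (toℕ c) (lookupℕ v k)
  high b≤k with lookupℕ v k | proj₂ (v-sep k k<n) b≤k
  ... | + m | ℤ.+<+ b<m rewrite t-large (toℕ c) m (ℕₚ.<-≤-trans (s≤s 2≤b) b<m) = ℤ.+<+ (swap-> b<m pivot≢b)

C-i⇒separated : ∀ {n} (u : Vec ℤ n) (i : Fin n) → 2 ≤ toℕ i → InD u → InC u i → Separated (toℕ i) u
C-i⇒separated {n} u i 2≤i u∈D i∈C =
  C-preserves u i u∈D i∈C (Separated (toℕ i)) (separated-idW n (toℕ i)) (λ c v → separated-t i 2≤i c v)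

SplitsAt : ∀ {n} → ℕ → Vec ℤ n → Set
SplitsAt {n} b u = ∀ j k → j ≤ b → b < k → k ≤ n → + ∣ uN u j ∣ ℤ.< uN u k

separated⇒splitsAt : ∀ {n} b (u : Vec ℤ n) → Separated b u → SplitsAt b u
separated⇒splitsAt b u u-sep j (suc k) j≤b (s≤s b≤k) k<n =
  ℤₚ.≤-<-trans (ℤ.+≤+ (bound j j≤b)) (proj₂ (u-sep k k<n) b≤k)
  where
  bound : ∀ j → j ≤ b → ∣ uN u j ∣ ≤ b
  bound zero    _     = z≤n
  bound (suc j) j<b = proj₁ (u-sep j (ℕₚ.<-≤-trans j<b (ℕₚ.≤-trans b≤k (ℕₚ.<⇒≤ k<n)))) j<b

status-below : ∀ σ x y → + ∣ x ∣ ℤ.< y → statusℤ σ x y ≡ Sign.+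
status-below σ x (+ k) (ℤ.+<+ ∣x∣<k) rewrite <⇒<ᵇ≡true ∣x∣<k = refl

status-above : ∀ σ x y → ∣ y ∣ < ∣ x ∣ → statusℤ σ x y ≡ opposite (σ Sign.* sign x)
status-above σ x y ∣y∣<∣x∣ rewrite ≮⇒<ᵇ≡false (ℕₚ.<⇒≯ ∣y∣<∣x∣) = refl

+<⇒<∣-∣ : ∀ {b z} → + b ℤ.< z → b < ∣ z ∣
+<⇒<∣-∣ (ℤ.+<+ b<m) = b<m

+<⇒≡∣-∣ : ∀ {b z} → + b ℤ.< z → z ≡ + ∣ z ∣
+<⇒≡∣-∣ (ℤ.+<+ _) = refl

pivot-suc : ∀ {c} → 1 ≤ c → pivot c ≡ c
pivot-suc {suc c} _ = refl

flip-suc : ∀ {c} m → 1 ≤ c → flip c m ≡ Sign.+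
flip-suc {suc c} _ _ = refl

t-pivot-above : ∀ c → 1 ≤ c → t c (+ suc c) ≡ + c
t-pivot-above (suc j) _ rewrite t-signAbs (suc j) (+ suc (suc j)) | swap-above (suc j) = refl

-- t_b sends the values ±b, b + 1 at positions p < b ≤ q to ±(b + 1), b.
splitsAt⇒C-i : ∀ {n} → 2 ≤ n → (u : Vec ℤ n) (i : Fin n) → 2 ≤ toℕ i → SplitsAt (toℕ i) u → InC u i
splitsAt⇒C-i {n} 2≤n u i 2≤b u-splits = C-by-new-inversion 2≤n u i new
  where
  b : ℕ
  b = toℕ i
  b<n : b < n
  b<n = Finₚ.toℕ<n i
  1≤b : 1 ≤ b
  1≤b = ℕₚ.<-trans (s≤s z≤n) 2≤b
  new : ∀ ys → i ∉ ys → ∃ λ a → ∃₂ λ b σ → a < b × b < n ×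
          Inversion (map (t (toℕ i)) (eval ys)) a b σ × ¬ Inversion u a b σ
  new ys i∉ys = at-positions (abs-surjective b 1≤b (ℕₚ.<⇒≤ b<n)) (abs-surjective (suc b) (s≤s z≤n) b<n)
    where
    v : Vec ℤ n
    v = eval ys
    open SignedPerm (signedPerm-eval 2≤n ys)
    v-sep : Separated b v
    v-sep = eval-preserves i (Separated b) (separated-idW n b) (λ c w → separated-t i 2≤b c w) ys i∉ys
    tv : ∀ k → lookupℕ (map (t b) v) k ≡ t b (lookupℕ v k)
    tv = lookup-map (t b) (t-zero b) v
    at-positions : (∃ λ p → p < n × ∣ lookupℕ v p ∣ ≡ b) → (∃ λ q → q < n × ∣ lookupℕ v q ∣ ≡ suc b) →
                   ∃ λ a → ∃₂ λ b σ → a < b × b < n × Inversion (map (t (toℕ i)) v) a b σ × ¬ Inversion u a b σ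
    at-positions (p , p<n , ∣vp∣) (q , q<n , ∣vq∣) =
      p , q , σ , ℕₚ.<-≤-trans p<b b≤q , q<n , inv ,
      ¬inversion-of-+ σ (lookupℕ u p) (lookupℕ u q) (status-below σ _ _ (u-splits (suc p) (suc q) p<b (s≤s b≤q) q<n))
      where
      x : ℤ
      x = lookupℕ v p
      σ : Sign
      σ = sign x
      p<b : p < b
      p<b = ℕₚ.≰⇒> (λ b≤p → ℕₚ.<-irrefl (sym ∣vp∣) (+<⇒<∣-∣ (proj₂ (v-sep p p<n) b≤p)))
      b≤q : b ≤ q
      b≤q = ℕₚ.≮⇒≥ (λ q<b → ℕₚ.1+n≰n (subst (_≤ b) ∣vq∣ (proj₁ (v-sep q q<n) q<b)))
      vq : lookupℕ v q ≡ + suc b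
      vq = trans (+<⇒≡∣-∣ (proj₂ (v-sep q q<n) b≤q)) (cong +_ ∣vq∣)
      tvq : lookupℕ (map (t b) v) q ≡ + b
      tvq = trans (tv q) (trans (cong (t b) vq) (t-pivot-above b 1≤b))
      ∣tx∣ : ∣ t b x ∣ ≡ suc b
      ∣tx∣ = trans (∣t∣ b x) (trans (cong₂ swap (pivot-suc 1≤b) ∣vp∣) (swap-at b))
      sign-tx : sign (t b x) ≡ σ
      sign-tx = trans (sign-t b x (subst (1 ≤_) (sym ∣vp∣) 1≤b))
                      (trans (cong (σ Sign.*_) (flip-suc ∣ x ∣ 1≤b)) (Signₚ.*-identityʳ σ))
      inv : Inversion (map (t b) v) p q σ
      inv = begin
        statusℤ σ (lookupℕ (map (t b) v) p) (lookupℕ (map (t b) v) q) ≡⟨ cong₂ (statusℤ σ) (tv p) tvq ⟩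
        statusℤ σ (t b x) (+ b)                  ≡⟨ status-above σ (t b x) (+ b) (subst (b <_) (sym ∣tx∣) (ℕₚ.n<1+n b)) ⟩
        opposite (σ Sign.* sign (t b x))         ≡⟨ cong (λ s → opposite (σ Sign.* s)) sign-tx ⟩
        opposite (σ Sign.* σ)                    ≡⟨ cong opposite (Signₚ.s*s≡+ σ) ⟩
        Sign.-                                   ∎
        where open ≡-Reasoning

-- Conjugation by τ₀, which exchanges t₀ and t₁

τ₀-odd : ∀ z → τ 0 (- z) ≡ - τ 0 z
τ₀-odd (+ zero)          = refl
τ₀-odd (+ suc zero)      = refl
τ₀-odd (+ suc (suc k))   = refl
τ₀-odd -[1+ zero ]       = refl
τ₀-odd -[1+ suc k ]      = refl

τ₀-involutive : ∀ z → τ 0 (τ 0 z) ≡ z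
τ₀-involutive (+ zero)          = refl
τ₀-involutive (+ suc zero)      = refl
τ₀-involutive (+ suc (suc k))   = refl
τ₀-involutive -[1+ zero ]       = refl
τ₀-involutive -[1+ suc k ]      = refl

τ₀-fix : ∀ z → ∣ z ∣ ≢ 1 → τ 0 z ≡ z
τ₀-fix (+ zero)          _   = refl
τ₀-fix (+ suc zero)      ∣z∣≢1 = ⊥-elim (∣z∣≢1 refl)
τ₀-fix (+ suc (suc k))   _   = refl
τ₀-fix -[1+ zero ]       ∣z∣≢1 = ⊥-elim (∣z∣≢1 refl)
τ₀-fix -[1+ suc k ]      _   = refl

∣t∣≢1 : ∀ j z → 2 ≤ ∣ z ∣ → ∣ t (suc (suc j)) z ∣ ≢ 1
∣t∣≢1 j z 2≤∣z∣ ∣tz∣≡1 =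
  ℕₚ.<-irrefl (sym (trans (sym (∣t∣ (suc (suc j)) z)) ∣tz∣≡1)) (swap-> 2≤∣z∣ (λ ()))

τ₀-t : ∀ c z → τ 0 (t c z) ≡ t (swap 0 c) (τ 0 z)
τ₀-t zero          (+ zero)                = refl
τ₀-t zero          (+ suc zero)            = refl
τ₀-t zero          (+ suc (suc zero))      = refl
τ₀-t zero          (+ suc (suc (suc k)))   = refl
τ₀-t zero          -[1+ zero ]             = refl
τ₀-t zero          -[1+ suc zero ]         = refl
τ₀-t zero          -[1+ suc (suc k) ]      = refl
τ₀-t (suc zero)    (+ zero)                = refl
τ₀-t (suc zero)    (+ suc zero)            = refl
τ₀-t (suc zero)    (+ suc (suc zero))      = refl
τ₀-t (suc zero)    (+ suc (suc (suc k)))   = refl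
τ₀-t (suc zero)    -[1+ zero ]             = refl
τ₀-t (suc zero)    -[1+ suc zero ]         = refl
τ₀-t (suc zero)    -[1+ suc (suc k) ]      = refl
τ₀-t (suc (suc j)) (+ zero)                = refl
τ₀-t (suc (suc j)) (+ suc zero)            = refl
τ₀-t (suc (suc j)) -[1+ zero ]             = refl
τ₀-t (suc (suc j)) (+ suc (suc k))         = τ₀-fix _ (∣t∣≢1 j (+ suc (suc k)) (s≤s (s≤s z≤n)))
τ₀-t (suc (suc j)) -[1+ suc k ]            = τ₀-fix _ (∣t∣≢1 j -[1+ suc k ] (s≤s (s≤s z≤n)))

-- the window of τ₀ v τ₀: τ₀ on the right negates v(1), τ₀ on the left
-- acts on every value
conj : ∀ {m} → Vec ℤ (suc m) → Vec ℤ (suc m)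
conj (x ∷ xs) = map (τ 0) ((- x) ∷ xs)

swap₀₁ : ∀ {m} → Fin (suc (suc m)) → Fin (suc (suc m))
swap₀₁ Fin.zero                 = Fin.suc Fin.zero
swap₀₁ (Fin.suc Fin.zero)       = Fin.zero
swap₀₁ (Fin.suc (Fin.suc c))    = Fin.suc (Fin.suc c)

toℕ-swap₀₁ : ∀ {m} (c : Fin (suc (suc m))) → toℕ (swap₀₁ c) ≡ swap 0 (toℕ c)
toℕ-swap₀₁ Fin.zero              = refl
toℕ-swap₀₁ (Fin.suc Fin.zero)    = refl
toℕ-swap₀₁ (Fin.suc (Fin.suc c)) = refl

conj-idW : ∀ m → conj (idW (suc (suc m))) ≡ idW (suc (suc m))
conj-idW m = cong (+ 1 ∷_) (sym (Vecₚ.tabulate-∘ (τ 0) (λ i → + suc (suc (toℕ i)))))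

conj-t : ∀ {m} c (v : Vec ℤ (suc m)) → conj (map (t c) v) ≡ map (t (swap 0 c)) (conj v)
conj-t c (x ∷ xs) = cong₂ _∷_
  (trans (cong (τ 0) (sym (t-odd c x))) (τ₀-t c (- x)))
  (trans (sym (Vecₚ.map-∘ (τ 0) (t c) xs))
         (trans (Vecₚ.map-cong (τ₀-t c) xs) (Vecₚ.map-∘ (t (swap 0 c)) (τ 0) xs)))

conj-involutive : ∀ {m} (v : Vec ℤ (suc m)) → conj (conj v) ≡ v
conj-involutive (x ∷ xs) = cong₂ _∷_
  (trans (cong (τ 0) (trans (sym (τ₀-odd (- x))) (cong (τ 0) (ℤₚ.neg-involutive x)))) (τ₀-involutive x))
  (trans (sym (Vecₚ.map-∘ (τ 0) (τ 0) xs)) (trans (Vecₚ.map-cong τ₀-involutive xs) (Vecₚ.map-id xs)))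

eval-swap₀₁ : ∀ {m} (w : List (Fin (suc (suc m)))) → eval (List.map swap₀₁ w) ≡ conj (eval w)
eval-swap₀₁ {m} []      = sym (conj-idW m)
eval-swap₀₁     (c ∷ w) =
  trans (cong₂ (λ k v → map (t k) v) (toℕ-swap₀₁ c) (eval-swap₀₁ w)) (sym (conj-t (toℕ c) (eval w)))

reduced-conj : ∀ {m} (u : Vec ℤ (suc (suc m))) w → Reduced u w → Reduced (conj u) (List.map swap₀₁ w)
reduced-conj u w (evals , minimal) = trans (eval-swap₀₁ w) (cong conj evals) , λ w′ w′-evals →
  subst₂ _≤_ (sym (Listₚ.length-map swap₀₁ w)) (Listₚ.length-map swap₀₁ w′)
    (minimal (List.map swap₀₁ w′) (trans (eval-swap₀₁ w′) (trans (cong conj w′-evals) (conj-involutive u))))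

InD-conj : ∀ {m} (u : Vec ℤ (suc (suc m))) → InD u → InD (conj u)
InD-conj u (w , evals) = List.map swap₀₁ w , trans (eval-swap₀₁ w) (cong conj evals)

C-one⇒C-zero-conj : ∀ {m} (u : Vec ℤ (suc (suc m))) → InC u (Fin.suc Fin.zero) → InC (conj u) Fin.zero
C-one⇒C-zero-conj u 1∈C (w , red , 0∈w) = 1∈C (List.map swap₀₁ w ,
  subst (λ v → Reduced v (List.map swap₀₁ w)) (conj-involutive u) (reduced-conj (conj u) w red) ,
  ∈-map⁺ swap₀₁ 0∈w)

C-zero-conj⇒C-one : ∀ {m} (u : Vec ℤ (suc (suc m))) → InC (conj u) Fin.zero → InC u (Fin.suc Fin.zero)
C-zero-conj⇒C-one u 0∈C (w , red , 1∈w) = 0∈C (List.map swap₀₁ w , reduced-conj u w red ,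
  ∈-map⁺ swap₀₁ 1∈w)

-- The condition for t₁

negCount-neg : ∀ {n} x (xs : Vec ℤ n) → sign x ≡ Sign.- → negCount (x ∷ xs) ≡ suc (negCount xs)
negCount-neg -[1+ _ ] xs _ = refl

negCount-pos : ∀ {n} x (xs : Vec ℤ n) → sign x ≡ Sign.+ → negCount (x ∷ xs) ≡ negCount xs
negCount-pos (+ _) xs _ = refl

negCount-∷ : ∀ {n} x (xs : Vec ℤ n) → negCount xs ≤ negCount (x ∷ xs)
negCount-∷ (+ _)    xs = ℕₚ.≤-refl
negCount-∷ -[1+ _ ] xs = ℕₚ.n≤1+n _

negative⇒< : ∀ {n} (v : Vec ℤ n) k → sign (lookupℕ v k) ≡ Sign.- → k < n
negative⇒< (x ∷ xs) zero    _   = s≤s z≤n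
negative⇒< (x ∷ xs) (suc k) neg = s≤s (negative⇒< xs k neg)

1≤negCount : ∀ {n} (v : Vec ℤ n) k → sign (lookupℕ v k) ≡ Sign.- → 1 ≤ negCount v
1≤negCount (x ∷ xs) zero    neg rewrite negCount-neg x xs neg = s≤s z≤n
1≤negCount (x ∷ xs) (suc k) neg = ℕₚ.≤-trans (1≤negCount xs k neg) (negCount-∷ x xs)

2≤negCount : ∀ {n} (v : Vec ℤ n) k l → k < l → sign (lookupℕ v k) ≡ Sign.- → sign (lookupℕ v l) ≡ Sign.- →
             2 ≤ negCount v
2≤negCount (x ∷ xs) zero    (suc l) _         neg neg′ rewrite negCount-neg x xs neg = s≤s (1≤negCount xs l neg′)
2≤negCount (x ∷ xs) (suc k) (suc l) (s≤s k<l) neg neg′ =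
  ℕₚ.≤-trans (2≤negCount xs k l k<l neg neg′) (negCount-∷ x xs)

negCount-positive : ∀ {n} (v : Vec ℤ n) → Positive v → negCount v ≡ 0
negCount-positive []       _     = refl
negCount-positive (x ∷ xs) v-pos rewrite negCount-pos x xs (v-pos 0 (s≤s z≤n)) =
  negCount-positive xs (λ k k<n → v-pos (suc k) (s≤s k<n))

negCount-single : ∀ {n} (v : Vec ℤ n) q → sign (lookupℕ v q) ≡ Sign.- →
                  (∀ k → k < n → k ≢ q → sign (lookupℕ v k) ≡ Sign.+) → negCount v ≡ 1
negCount-single (x ∷ xs) zero neg others rewrite negCount-neg x xs neg =
  cong suc (negCount-positive xs (λ k k<n → others (suc k) (s≤s k<n) (λ ())))
negCount-single (x ∷ xs) (suc q) neg others rewrite negCount-pos x xs (others 0 (s≤s z≤n) (λ ())) =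
  negCount-single xs q neg (λ k k<n k≢q → others (suc k) (s≤s k<n) (λ e → k≢q (ℕₚ.suc-injective e)))

lookup-conj : ∀ {m} x (xs : Vec ℤ (suc m)) k → lookupℕ (conj (x ∷ xs)) (suc k) ≡ τ 0 (lookupℕ xs k)
lookup-conj x xs = lookup-map (τ 0) refl xs

0<⇒sign≡+ : ∀ {z} → + 0 ℤ.< z → sign z ≡ Sign.+
0<⇒sign≡+ (ℤ.+<+ _) = refl

sign≡+⇒0< : ∀ z → sign z ≡ Sign.+ → 1 ≤ ∣ z ∣ → + 0 ℤ.< z
sign≡+⇒0< (+ suc m) _ _ = ℤ.+<+ (s≤s z≤n)

τ₀-positive-unit : ∀ z → ∣ z ∣ ≡ 1 → sign (τ 0 z) ≡ Sign.+ → z ≡ -[1+ 0 ]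
τ₀-positive-unit -[1+ zero ]  _ _ = refl
τ₀-positive-unit (+ suc zero) _ ()

special⇒positive-conj : ∀ {m} (u : Vec ℤ (suc (suc m))) → SignedPerm u → Special u → Positive (conj u)
special⇒positive-conj (x ∷ xs) sp (inj₁ (x≡1 , u-pos)) = conj-pos
  where
  open SignedPerm sp
  ∣xs∣≢1 : ∀ k → suc k < suc (suc _) → ∣ lookupℕ xs k ∣ ≢ 1
  ∣xs∣≢1 k k<n e with () ← abs-injective (suc k) 0 k<n (s≤s z≤n) (trans e (cong ∣_∣ (sym x≡1)))
  conj-pos : Positive (conj (x ∷ xs))
  conj-pos zero    _   rewrite x≡1 = refl
  conj-pos (suc k) k<n rewrite lookup-conj x xs k | τ₀-fix (lookupℕ xs k) (∣xs∣≢1 k k<n) =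
    0<⇒sign≡+ (u-pos (suc (suc k)) (s≤s z≤n) k<n)
special⇒positive-conj {m} (-[1+ suc a ] ∷ xs) sp (inj₂ (ℤ.-<- _ , (-[1+ suc q ] , u-q≡1 , ℤ.-<- _) , two)) =
  conj-pos
  where
  open SignedPerm sp
  xs-q : lookupℕ xs q ≡ -[1+ 0 ]
  xs-q = trans (sym (ℤₚ.neg-involutive _)) (cong -_ u-q≡1)
  q<n : suc q < suc (suc m)
  q<n = s≤s (negative⇒< xs q (cong sign xs-q))
  ∣xs∣≢1 : ∀ k → suc k < suc (suc m) → k ≢ q → ∣ lookupℕ xs k ∣ ≢ 1
  ∣xs∣≢1 k k<n k≢q e =
    k≢q (ℕₚ.suc-injective (abs-injective (suc k) (suc q) k<n q<n (trans e (sym (cong ∣_∣ xs-q)))))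
  three : ∀ k → k ≢ q → sign (lookupℕ xs k) ≡ Sign.- → 2 < negCount (-[1+ suc a ] ∷ xs)
  three k k≢q neg with ℕₚ.<-cmp k q
  ... | tri< k<q _ _ = s≤s (2≤negCount xs k q k<q neg (cong sign xs-q))
  ... | tri≈ _ k≡q _ = ⊥-elim (k≢q k≡q)
  ... | tri> _ _ q<k = s≤s (2≤negCount xs q k q<k (cong sign xs-q) neg)
  other : ∀ k → suc k < suc (suc m) → k ≢ q → sign (τ 0 (lookupℕ xs k)) ≡ Sign.+
  other k k<n k≢q rewrite τ₀-fix (lookupℕ xs k) (∣xs∣≢1 k k<n k≢q) with sign (lookupℕ xs k) in neg
  ... | Sign.+ = refl
  ... | Sign.- = ⊥-elim (ℕₚ.<-irrefl (sym two) (three k k≢q neg))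
  conj-pos : Positive (conj (-[1+ suc a ] ∷ xs))
  conj-pos zero    _   = refl
  conj-pos (suc k) k<n rewrite lookup-conj -[1+ suc a ] xs k with k ℕ.≟ q
  ... | yes refl rewrite xs-q = refl
  ... | no k≢q = other k k<n k≢q

positive-conj⇒special : ∀ {m} (u : Vec ℤ (suc (suc m))) → SignedPerm u → Positive (conj u) → Special u
positive-conj⇒special (+ zero ∷ xs) sp _ with () ← SignedPerm.nonzero sp 0 (s≤s z≤n)
positive-conj⇒special (+ suc (suc a) ∷ xs) sp conj-pos with () ← conj-pos 0 (s≤s z≤n)
positive-conj⇒special (-[1+ zero ] ∷ xs) sp conj-pos with () ← conj-pos 0 (s≤s z≤n)
positive-conj⇒special {m} (+ suc zero ∷ xs) sp conj-pos = inj₁ (refl , u-pos)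
  where
  open SignedPerm sp
  u-pos : ∀ k → 1 ≤ k → k ≤ suc (suc m) → + 0 ℤ.< uN (+ 1 ∷ xs) k
  u-pos (suc zero)    _ _   = ℤ.+<+ (s≤s z≤n)
  u-pos (suc (suc k)) _ k<n = sign≡+⇒0< (lookupℕ xs k) sign-xs-k (nonzero (suc k) k<n)
    where
    ∣xs-k∣≢1 : ∣ lookupℕ xs k ∣ ≢ 1
    ∣xs-k∣≢1 e with () ← abs-injective (suc k) 0 k<n (s≤s z≤n) e
    sign-xs-k : sign (lookupℕ xs k) ≡ Sign.+
    sign-xs-k = trans (cong sign (sym (τ₀-fix _ ∣xs-k∣≢1)))
                      (trans (cong sign (sym (lookup-conj (+ 1) xs k))) (conj-pos (suc k) k<n))
positive-conj⇒special {m} (-[1+ suc a ] ∷ xs) sp conj-pos = from-unit (abs-surjective 1 (s≤s z≤n) (s≤s z≤n))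
  where
  open SignedPerm sp
  u : Vec ℤ (suc (suc m))
  u = -[1+ suc a ] ∷ xs
  from-unit : (∃ λ k → k < suc (suc m) × ∣ lookupℕ u k ∣ ≡ 1) → Special u
  from-unit (suc q , q<n , ∣xs-q∣) =
    inj₂ (ℤ.-<- (s≤s z≤n) , (-[1+ suc q ] , cong -_ xs-q , ℤ.-<- (s≤s z≤n)) , cong suc one)
    where
    sign-τ₀-xs : ∀ k → suc k < suc (suc m) → sign (τ 0 (lookupℕ xs k)) ≡ Sign.+
    sign-τ₀-xs k k<n = trans (cong sign (sym (lookup-conj -[1+ suc a ] xs k))) (conj-pos (suc k) k<n)
    xs-q : lookupℕ xs q ≡ -[1+ 0 ]
    xs-q = τ₀-positive-unit (lookupℕ xs q) ∣xs-q∣ (sign-τ₀-xs q q<n)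
    one : negCount xs ≡ 1
    one = negCount-single xs q (cong sign xs-q) λ k k<n k≢q →
      trans (cong sign (sym (τ₀-fix _ λ e → k≢q (ℕₚ.suc-injective
              (abs-injective (suc k) (suc q) (s≤s k<n) q<n (trans e (sym ∣xs-q∣)))))))
            (sign-τ₀-xs k (s≤s k<n))

-- The theorem

signedPerm-D : ∀ {n} → 2 ≤ n → (u : Vec ℤ n) → InD u → SignedPerm u
signedPerm-D 2≤n u (w , evals) = subst SignedPerm evals (signedPerm-eval 2≤n w)

C-zero⇔A : ∀ {n} → 2 ≤ suc n → (u : Vec ℤ (suc n)) → InD u → InC u Fin.zero ⇔ InA u Fin.zero
C-zero⇔A 2≤n u u∈D = mk⇔
  (λ 0∈C → (λ ()) , positive⇒splitsAt (C-zero⇒positive u u∈D 0∈C))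
  (λ (_ , splits) → positive⇒C-zero 2≤n u λ k k<n → 0<⇒sign≡+ (splits 0 (suc k) z≤n (s≤s z≤n) k<n))
  where
  positive⇒splitsAt : Positive u → SplitsAt 0 u
  positive⇒splitsAt u-pos zero (suc k) _ _ k<n =
    sign≡+⇒0< (lookupℕ u k) (u-pos k k<n) (SignedPerm.nonzero (signedPerm-D 2≤n u u∈D) k k<n)

C-one⇔special : ∀ {m} (u : Vec ℤ (suc (suc m))) → InD u → InC u (Fin.suc Fin.zero) ⇔ Special u
C-one⇔special u u∈D = mk⇔
  (λ 1∈C → positive-conj⇒special u sp (C-zero⇒positive (conj u) (InD-conj u u∈D) (C-one⇒C-zero-conj u 1∈C)))
  (λ special → C-zero-conj⇒C-one u (positive⇒C-zero (s≤s (s≤s z≤n)) (conj u) (special⇒positive-conj u sp special)))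
  where
  sp : SignedPerm u
  sp = signedPerm-D (s≤s (s≤s z≤n)) u u∈D

C-i⇔A : ∀ {n} → 2 ≤ n → (u : Vec ℤ n) (i : Fin n) → 2 ≤ toℕ i → InD u → InC u i ⇔ InA u i
C-i⇔A 2≤n u i 2≤i u∈D = mk⇔
  (λ i∈C → (λ i≡1 → ℕₚ.<-irrefl (sym i≡1) 2≤i) ,
           separated⇒splitsAt (toℕ i) u (C-i⇒separated u i 2≤i u∈D i∈C))
  (λ (_ , splits) → splitsAt⇒C-i 2≤n u i 2≤i splits)

mainTheorem18 : (n : ℕ) → 2 ≤ n → (u : Vec ℤ n) → InD u →
    (Special u → (i : Fin n) → InC u i ⇔ ((toℕ i ≡ 1) ⊎ InA u i)) ×
    (¬ Special u → (i : Fin n) → InC u i ⇔ InA u i)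
mainTheorem18 (suc zero)    (s≤s ())
mainTheorem18 (suc (suc m)) 2≤n u u∈D = special , not-special
  where
  open Equivalence
  2≤i : ∀ j → 2 ≤ toℕ (Fin.suc (Fin.suc j))
  2≤i j = s≤s (s≤s z≤n)
  special : Special u → (i : Fin (suc (suc m))) → InC u i ⇔ ((toℕ i ≡ 1) ⊎ InA u i)
  special s Fin.zero                = ⇔-inj₂ (λ ()) (C-zero⇔A 2≤n u u∈D)
  special s (Fin.suc Fin.zero)      = mk⇔ (λ _ → inj₁ refl) (λ _ → from (C-one⇔special u u∈D) s)
  special s i@(Fin.suc (Fin.suc j)) = ⇔-inj₂ (λ ()) (C-i⇔A 2≤n u i (2≤i j) u∈D)
  not-special : ¬ Special u → (i : Fin (suc (suc m))) → InC u i ⇔ InA u i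
  not-special ¬s Fin.zero                = C-zero⇔A 2≤n u u∈D
  not-special ¬s (Fin.suc Fin.zero)      =
    mk⇔ (λ 1∈C → ⊥-elim (¬s (to (C-one⇔special u u∈D) 1∈C))) (λ (1≢1 , _) → ⊥-elim (1≢1 refl))
  not-special ¬s i@(Fin.suc (Fin.suc j)) = C-i⇔A 2≤n u i (2≤i j) u∈D
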